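{- Let $n\ge 13$ and let $\mathcal{F}$ be a family of subsets of $[n]$. Assume that there are no 4 different sets $A,B,C,D\in\mathcal{F}$ such that $A\subset C$, $A\subset D$, $B\subset C$, $B\subset D$, and either $|A|=|B|$ or $|C|=|D|$. Then $|\mathcal{F}|\le\Sigma(n,2)$.
   Context: $[n]=\{1,2,\dots,n\}$. For integers $n,k$, $\Sigma(n,k)=\sum_{i=\lceil\frac{n-k}{2}\rceil}^{\lceil\frac{n+k}{2}\rceil-1}\binom{n}{i}$ denotes the sum of the $k$ largest binomial coefficients $\binom{n}{i}$. -}

module Defs where

open import Data.Nat using (ℕ; zero; suc; _+_; _∸_; ⌈_/2⌉)
open import Data.Nat.Combinatorics using (_C_)
open import Data.List using (List; map; upTo)
open import Data.Nat.ListAction using (sum)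
open import Data.Fin.Subset using (Subset; _⊂_; ∣_∣)
open import Data.List.Membership.Propositional using (_∈_)
open import Relation.Binary.PropositionalEquality using (_≡_; _≢_)
open import Data.Product using (_×_)
open import Data.Sum using (_⊎_)
open import Data.Empty using (⊥)

sumRange : ℕ → ℕ → (ℕ → ℕ) → ℕ
sumRange a b f = sum (map (λ j → f (a + j)) (upTo (b ∸ a)))

-- Σ(n,k) = Σ_{i=⌈(n-k)/2⌉}^{⌈(n+k)/2⌉-1} (n choose i), for 0 ≤ k ≤ n
Σbin : ℕ → ℕ → ℕ
Σbin n k = sumRange ⌈ (n ∸ k) /2⌉ ⌈ (n + k) /2⌉ (λ i → n C i)

Forbidden : ∀ {n} → List (Subset n) → Set
Forbidden {n} F =
  (A B C D : Subset n) →
  A ∈ F → B ∈ F → C ∈ F → D ∈ F →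
  A ≢ B → A ≢ C → A ≢ D → B ≢ C → B ≢ D → C ≢ D →
  A ⊂ C → A ⊂ D → B ⊂ C → B ⊂ D →
  (∣ A ∣ ≡ ∣ B ∣ ⊎ ∣ C ∣ ≡ ∣ D ∣) → ⊥

{-# OPTIONS --safe #-}

-- Let L consist of the members of F other than ∅ and [n], and call M ∈ L inner if F has members
-- strictly below and strictly above M.  The hypothesis forces the members of L below an inner M
-- to have distinct sizes, and likewise those above.  If a maximal chain meets L in X sets of
-- which R are inner, then X - 2 ≤ R (X - 2), because R ≥ 1 as soon as X ≥ 3; equivalently
-- X - 2 ≤ ∑ (d_M - 1) over the inner M on the chain, d_M being the number of other members of L
-- on it.  Averaging over all maximal chains, the mean of d_M over the chains through an M of
-- size m is at most h(m) + h(n - m), where h(m) = ∑_{0<d<m} 1 / (m C d).  For n ≥ 13 this is at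
-- most 99/100, so the mean of X is at most 2 - r/100, where r is the mean number of inner sets.
-- If neither ∅ nor [n] is in F, the bound 2 suffices.  Otherwise the non-inner sets of L are an
-- antichain, so X has mean at most 1 + r as well, hence at most 201/101, and the gain over 2
-- pays for ∅ and [n].
module Submission where

open import Defs
open import Data.Nat using (ℕ; zero; suc; _+_; _*_; _∸_; _≤_; _<_; z≤n; s≤s; _!; ⌈_/2⌉; ⌊_/2⌋)
open import Data.Nat.Combinatorics using
  (_C_; nCk≡n!/k![n-k]!; k![n∸k]!∣n!; nCk+nC[k+1]≡[n+1]C[k+1])
open import Data.Nat.DivMod using (_/_; m/n*n≡m)
open import Data.Nat.Properties
open import Data.Nat.ListAction using (sum)
open import Data.Nat.ListAction.Properties using (sum-++)
open import Data.Nat.Tactic.RingSolver using (solve-∀)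
import Data.Bool.Properties as Bool
open import Data.List using (List; []; _∷_; length; map; _++_; concatMap; filter)
open import Data.List.Properties using (map-++; length-map; filter-all)
open import Data.List.Relation.Unary.All using ([]; _∷_)
import Data.List.Relation.Unary.All as All
open import Data.List.Relation.Unary.All.Properties using (¬All⇒Any¬)
open import Data.List.Relation.Unary.AllPairs using ([]; _∷_)
open import Data.List.Relation.Unary.Any using (Any; here; there; any?)
open import Data.List.Relation.Unary.Unique.Propositional using (Unique)
open import Data.List.Membership.Propositional using (_∈_; find; lose)
import Data.List.Membership.DecPropositional as DecPropositional
open import Data.List.Membership.Propositional.Properties using (∈-map⁻; ∈-concat⁻′; ∈-filter⁻)
import Data.List.Relation.Unary.Unique.Propositional.Properties as Unique
open import Data.Fin.Subset using (Subset; inside; outside; _⊆_; _⊂_; ∣_∣; ⊤; ⊥)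
open import Data.Fin.Subset.Properties using
  (_⊆?_; _⊂?_; ⊆-refl; ⊆-trans; drop-∷-⊆; s⊆s; out⊆; p⊆q⇒∣p∣≤∣q∣; p⊂q⇒∣p∣<∣q∣; p⊂q⇒p⊆q; ∣p∣≤n;
   ∣⊤∣≡n; ⊆⊤; out⊂in; s⊂s; ⊂-irref; ⊂-trans; ⊥⊆; ∣⊥∣≡0; ∣p∣≡n⇒p≡⊤)
import Data.Vec.Base as Vec
open Vec using ([]; _∷_)
import Data.Vec.Properties as Vec
open import Data.Product using (∃; _×_; _,_; proj₁; proj₂)
open import Data.Sum using (_⊎_; inj₁; inj₂)
open import Function using (_∘_)
open import Relation.Nullary using (¬_; Dec; yes; no; contradiction; ¬?; _×-dec_; _→-dec_)
open import Relation.Nullary.Decidable using (from-yes)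
open import Relation.Unary using (Decidable)
open import Relation.Binary.PropositionalEquality using
  (_≡_; _≢_; refl; sym; trans; cong; cong₂; subst; module ≡-Reasoning)

private variable
  A B : Set
  n : ℕ

-- Finite sums and indicator functions.

∑ : List A → (A → ℕ) → ℕ
∑ xs f = sum (map f xs)

𝟙 : {P : Set} → Dec P → ℕ
𝟙 (yes _) = 1
𝟙 (no _)  = 0

𝟙-yes : {P : Set} (d : Dec P) → P → 𝟙 d ≡ 1
𝟙-yes (yes _) _ = refl
𝟙-yes (no ¬p) p = contradiction p ¬p

𝟙-no : {P : Set} (d : Dec P) → ¬ P → 𝟙 d ≡ 0
𝟙-no (yes p) ¬p = contradiction p ¬p
𝟙-no (no _)  _  = refl

𝟙-cong : {P Q : Set} (d : Dec P) (e : Dec Q) → (P → Q) → (Q → P) → 𝟙 d ≡ 𝟙 e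
𝟙-cong (yes p) e f g = sym (𝟙-yes e (f p))
𝟙-cong (no ¬p) e f g = sym (𝟙-no e (¬p ∘ g))

𝟙≤1 : {P : Set} (d : Dec P) → 𝟙 d ≤ 1
𝟙≤1 (yes _) = ≤-refl
𝟙≤1 (no _)  = z≤n

∑-mono : ∀ (xs : List A) {f g : A → ℕ} → (∀ {x} → x ∈ xs → f x ≤ g x) → ∑ xs f ≤ ∑ xs g
∑-mono []       h = z≤n
∑-mono (x ∷ xs) h = +-mono-≤ (h (here refl)) (∑-mono xs (h ∘ there))

∑-cong : ∀ (xs : List A) {f g : A → ℕ} → (∀ {x} → x ∈ xs → f x ≡ g x) → ∑ xs f ≡ ∑ xs g
∑-cong []       h = refl
∑-cong (x ∷ xs) h = cong₂ _+_ (h (here refl)) (∑-cong xs (h ∘ there))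

∑-+ : ∀ (xs : List A) (f g : A → ℕ) → ∑ xs (λ x → f x + g x) ≡ ∑ xs f + ∑ xs g
∑-+ []       f g = refl
∑-+ (x ∷ xs) f g = trans (cong (f x + g x +_) (∑-+ xs f g)) (interchange (f x) (g x) (∑ xs f) (∑ xs g))
  where
  interchange : ∀ a b c d → a + b + (c + d) ≡ a + c + (b + d)
  interchange = solve-∀

∑-*ˡ : ∀ (xs : List A) c (f : A → ℕ) → ∑ xs (λ x → c * f x) ≡ c * ∑ xs f
∑-*ˡ []       c f = sym (*-zeroʳ c)
∑-*ˡ (x ∷ xs) c f = trans (cong (c * f x +_) (∑-*ˡ xs c f)) (sym (*-distribˡ-+ c (f x) (∑ xs f)))

∑-*ʳ : ∀ (xs : List A) c (f : A → ℕ) → ∑ xs (λ x → f x * c) ≡ ∑ xs f * c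
∑-*ʳ []       c f = refl
∑-*ʳ (x ∷ xs) c f = trans (cong (f x * c +_) (∑-*ʳ xs c f)) (sym (*-distribʳ-+ c (f x) (∑ xs f)))

∑-0 : ∀ (xs : List A) → ∑ xs (λ _ → 0) ≡ 0
∑-0 []       = refl
∑-0 (x ∷ xs) = ∑-0 xs

∑-const : ∀ (xs : List A) c → ∑ xs (λ _ → c) ≡ length xs * c
∑-const []       c = refl
∑-const (x ∷ xs) c = cong (c +_) (∑-const xs c)

∑-swap : ∀ (xs : List A) (ys : List B) (f : A → B → ℕ) →
  ∑ xs (λ x → ∑ ys (f x)) ≡ ∑ ys (λ y → ∑ xs (λ x → f x y))
∑-swap []       ys f = sym (∑-0 ys)
∑-swap (x ∷ xs) ys f = trans (cong (∑ ys (f x) +_) (∑-swap xs ys f))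
                             (sym (∑-+ ys (f x) (λ y → ∑ xs (λ x → f x y))))

∑-map : ∀ (h : A → B) (xs : List A) (f : B → ℕ) → ∑ (map h xs) f ≡ ∑ xs (f ∘ h)
∑-map h []       f = refl
∑-map h (x ∷ xs) f = cong (f (h x) +_) (∑-map h xs f)

∑-concatMap : ∀ (h : A → List B) (xs : List A) (f : B → ℕ) →
  ∑ (concatMap h xs) f ≡ ∑ xs (λ x → ∑ (h x) f)
∑-concatMap h []       f = refl
∑-concatMap h (x ∷ xs) f = begin
  sum (map f (h x ++ concatMap h xs))    ≡⟨ cong sum (map-++ f (h x) _) ⟩
  sum (map f (h x) ++ map f (concatMap h xs)) ≡⟨ sum-++ (map f (h x)) _ ⟩
  ∑ (h x) f + ∑ (concatMap h xs) f       ≡⟨ cong (∑ (h x) f +_) (∑-concatMap h xs f) ⟩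
  ∑ (h x) f + ∑ xs (λ x → ∑ (h x) f)     ∎
  where open ≡-Reasoning

f[x]≤∑ : ∀ {x} {xs : List A} (f : A → ℕ) → x ∈ xs → f x ≤ ∑ xs f
f[x]≤∑ f (here refl)       = m≤m+n _ _
f[x]≤∑ {xs = y ∷ _} f (there x∈) = ≤-trans (f[x]≤∑ f x∈) (m≤n+m _ (f y))

∑-filter : ∀ {P : A → Set} (P? : Decidable P) (xs : List A) (f : A → ℕ) →
  ∑ (filter P? xs) f ≡ ∑ xs (λ x → 𝟙 (P? x) * f x)
∑-filter P? []       f = refl
∑-filter P? (x ∷ xs) f with P? x
... | yes _ = cong₂ _+_ (sym (*-identityˡ (f x))) (∑-filter P? xs f)
... | no _  = ∑-filter P? xs f

∑-𝟙≤1 : ∀ {P : A → Set} (P? : Decidable P) {xs : List A} → Unique xs →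
  (∀ {x y} → x ∈ xs → y ∈ xs → P x → P y → x ≡ y) → ∑ xs (𝟙 ∘ P?) ≤ 1
∑-𝟙≤1 P? {[]}     []       inj = z≤n
∑-𝟙≤1 P? {x ∷ xs} (x∉ ∷ u) inj with P? x
... | no _   = ∑-𝟙≤1 P? u (λ x∈ y∈ → inj (there x∈) (there y∈))
... | yes px = ≤-reflexive (cong suc (trans (∑-cong xs none) (∑-0 xs)))
  where
  none : ∀ {y} → y ∈ xs → 𝟙 (P? y) ≡ 0
  none {y} y∈ = 𝟙-no (P? y) λ py → All.lookup x∉ y∈ (inj (here refl) (there y∈) px py)

-- Splitting by the value `k` of the key and exchanging the sums, each `k` is hit by at most one `x`
-- with `P x`, so it contributes at most `f k`. This later replaces sums over family members of
-- distinct sizes by sums over all possible sizes.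
∑-inj : ∀ {P : A → Set} (P? : Decidable P) (key : A → ℕ) (ks : List ℕ) {xs : List A} → Unique xs →
  (∀ {x y} → x ∈ xs → y ∈ xs → P x → P y → key x ≡ key y → x ≡ y) →
  (∀ {x} → x ∈ xs → P x → key x ∈ ks) →
  (f : ℕ → ℕ) → ∑ xs (λ x → 𝟙 (P? x) * f (key x)) ≤ ∑ ks f
∑-inj {A = A} {P = P} P? key ks {xs} u inj range f = begin
  ∑ xs (λ x → 𝟙 (P? x) * f (key x))
    ≤⟨ ∑-mono xs spread ⟩
  ∑ xs (λ x → ∑ ks (λ k → 𝟙 (hit? k x) * f k))
    ≡⟨ ∑-swap xs ks _ ⟩
  ∑ ks (λ k → ∑ xs (λ x → 𝟙 (hit? k x) * f k))
    ≤⟨ ∑-mono ks (λ {k} _ → bound k) ⟩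
  ∑ ks f ∎
  where
  open ≤-Reasoning
  hit? : ∀ k → Decidable (λ x → P x × key x ≡ k)
  hit? k x = P? x ×-dec (key x ≟ k)
  spread : ∀ {x} → x ∈ xs → 𝟙 (P? x) * f (key x) ≤ ∑ ks (λ k → 𝟙 (hit? k x) * f k)
  spread {x} x∈ with P? x in eq
  ... | no _   = z≤n
  ... | yes px = ≤-trans (≤-reflexive (cong (_* f (key x)) (sym (𝟙-yes (yes px ×-dec (key x ≟ key x)) (px , refl)))))
                         (f[x]≤∑ (λ k → 𝟙 (yes px ×-dec (key x ≟ k)) * f k) (range x∈ px))
  bound : ∀ k → ∑ xs (λ x → 𝟙 (hit? k x) * f k) ≤ f k
  bound k = begin
    ∑ xs (λ x → 𝟙 (hit? k x) * f k) ≡⟨ ∑-*ʳ xs (f k) (𝟙 ∘ hit? k) ⟩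
    ∑ xs (𝟙 ∘ hit? k) * f k         ≤⟨ *-monoˡ-≤ (f k) (∑-𝟙≤1 (hit? k) u λ x∈ y∈ (px , ex) (py , ey) → inj x∈ y∈ px py (trans ex (sym ey))) ⟩
    1 * f k                         ≡⟨ *-identityˡ (f k) ⟩
    f k ∎

-- Subsets and their one-element deletions.

_≟ˢ_ : (A B : Subset n) → Dec (A ≡ B)
_≟ˢ_ = Vec.≡-dec Bool._≟_

⊆∧∣≡∣⇒≡ : ∀ {A B : Subset n} → A ⊆ B → ∣ A ∣ ≡ ∣ B ∣ → A ≡ B
⊆∧∣≡∣⇒≡ {A = []}          {[]}          _   _ = refl
⊆∧∣≡∣⇒≡ {A = outside ∷ A} {outside ∷ B} A⊆B e = cong (outside ∷_) (⊆∧∣≡∣⇒≡ (drop-∷-⊆ A⊆B) e)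
⊆∧∣≡∣⇒≡ {A = outside ∷ A} {inside ∷ B}  A⊆B e = contradiction (p⊆q⇒∣p∣≤∣q∣ (drop-∷-⊆ A⊆B)) (<⇒≱ (≤-reflexive (sym e)))
⊆∧∣≡∣⇒≡ {A = inside ∷ A}  {outside ∷ B} A⊆B e with () ← A⊆B Vec.here
⊆∧∣≡∣⇒≡ {A = inside ∷ A}  {inside ∷ B}  A⊆B e = cong (inside ∷_) (⊆∧∣≡∣⇒≡ (drop-∷-⊆ A⊆B) (suc-injective e))

⊆∧≢⇒⊂ : ∀ {A B : Subset n} → A ⊆ B → A ≢ B → A ⊂ B
⊆∧≢⇒⊂ {A = []}          {[]}          _   A≢B = contradiction refl A≢B
⊆∧≢⇒⊂ {A = outside ∷ A} {outside ∷ B} A⊆B A≢B = s⊂s (⊆∧≢⇒⊂ (drop-∷-⊆ A⊆B) (A≢B ∘ cong (outside ∷_)))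
⊆∧≢⇒⊂ {A = outside ∷ A} {inside ∷ B}  A⊆B A≢B = out⊂in (drop-∷-⊆ A⊆B)
⊆∧≢⇒⊂ {A = inside ∷ A}  {outside ∷ B} A⊆B A≢B with () ← A⊆B Vec.here
⊆∧≢⇒⊂ {A = inside ∷ A}  {inside ∷ B}  A⊆B A≢B = s⊂s (⊆∧≢⇒⊂ (drop-∷-⊆ A⊆B) (A≢B ∘ cong (inside ∷_)))

⊂⇒≢ : ∀ {A B : Subset n} → A ⊂ B → A ≢ B
⊂⇒≢ A⊂B A≡B = ⊂-irref A≡B A⊂B

minors : Subset n → List (Subset n)
minors []            = []
minors (outside ∷ S) = map (outside ∷_) (minors S)
minors (inside ∷ S)  = (outside ∷ S) ∷ map (inside ∷_) (minors S)

minors-⊆ : ∀ (S : Subset n) {T} → T ∈ minors S → T ⊆ S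
minors-⊆ (outside ∷ S) T∈ with _ , T'∈ , refl ← ∈-map⁻ _ T∈ = s⊆s (minors-⊆ S T'∈)
minors-⊆ (inside ∷ S) (here refl) = out⊆ ⊆-refl
minors-⊆ (inside ∷ S) (there T∈) with _ , T'∈ , refl ← ∈-map⁻ _ T∈ = s⊆s (minors-⊆ S T'∈)

minors-size : ∀ (S : Subset n) {T} → T ∈ minors S → suc ∣ T ∣ ≡ ∣ S ∣
minors-size (outside ∷ S) T∈ with _ , T'∈ , refl ← ∈-map⁻ _ T∈ = minors-size S T'∈
minors-size (inside ∷ S) (here refl) = refl
minors-size (inside ∷ S) (there T∈) with _ , T'∈ , refl ← ∈-map⁻ _ T∈ = cong suc (minors-size S T'∈)

length-minors : ∀ (S : Subset n) → length (minors S) ≡ ∣ S ∣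
length-minors []            = refl
length-minors (outside ∷ S) = trans (length-map _ (minors S)) (length-minors S)
length-minors (inside ∷ S)  = cong suc (trans (length-map _ (minors S)) (length-minors S))

-- Deleting an element of `S` leaves a superset of `A` exactly when that element lies outside `A`.
-- The additive form avoids truncated subtraction.
count-minors-⊇ : ∀ {A S : Subset n} → A ⊆ S → ∣ A ∣ + ∑ (minors S) (λ T → 𝟙 (A ⊆? T)) ≡ ∣ S ∣
count-minors-⊇ {A = []} {[]} A⊆S = refl
count-minors-⊇ {A = a ∷ A} {s ∷ S} A⊆S = go a s A⊆S
  where
  open ≡-Reasoning
  ih = count-minors-⊇ (drop-∷-⊆ A⊆S)
  N = ∑ (minors S) (λ T → 𝟙 (A ⊆? T))
  same : ∀ t → ∑ (map (t ∷_) (minors S)) (λ T → 𝟙 ((t ∷ A) ⊆? T)) ≡ N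
  same t = trans (∑-map _ (minors S) _) (∑-cong (minors S) λ {T} _ → 𝟙-cong ((t ∷ A) ⊆? (t ∷ T)) (A ⊆? T) drop-∷-⊆ s⊆s)
  go : ∀ a s → (a ∷ A) ⊆ (s ∷ S) → ∣ a ∷ A ∣ + ∑ (minors (s ∷ S)) (λ T → 𝟙 ((a ∷ A) ⊆? T)) ≡ ∣ s ∷ S ∣
  go outside outside _ = trans (cong (∣ A ∣ +_) (same outside)) ih
  go outside inside  _ = begin
    ∣ A ∣ + (𝟙 ((outside ∷ A) ⊆? (outside ∷ S)) + ∑ (map (inside ∷_) (minors S)) (λ T → 𝟙 ((outside ∷ A) ⊆? T)))
      ≡⟨ cong₂ (λ x y → ∣ A ∣ + (x + y)) (𝟙-yes ((outside ∷ A) ⊆? (outside ∷ S)) (s⊆s (drop-∷-⊆ A⊆S)))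
           (trans (∑-map _ (minors S) _) (∑-cong (minors S) λ {T} _ → 𝟙-cong ((outside ∷ A) ⊆? (inside ∷ T)) (A ⊆? T) drop-∷-⊆ out⊆)) ⟩
    ∣ A ∣ + suc N ≡⟨ +-suc ∣ A ∣ N ⟩
    suc (∣ A ∣ + N) ≡⟨ cong suc ih ⟩
    suc ∣ S ∣ ∎
  go inside outside sub with () ← sub Vec.here
  go inside inside _ = cong suc (begin
    ∣ A ∣ + (𝟙 ((inside ∷ A) ⊆? (outside ∷ S)) + ∑ (map (inside ∷_) (minors S)) (λ T → 𝟙 ((inside ∷ A) ⊆? T)))
      ≡⟨ cong₂ (λ x y → ∣ A ∣ + (x + y)) (𝟙-no ((inside ∷ A) ⊆? (outside ∷ S)) (λ sub → contradiction (sub Vec.here) λ ())) (same inside) ⟩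
    ∣ A ∣ + N ≡⟨ ih ⟩
    ∣ S ∣ ∎)

-- Maximal chains

-- The counter `k` carries the recursion and is meant to be `∣ S ∣`: each chain, listed from its
-- largest set, then loses one element at a time until it reaches the empty set.
chains : ℕ → Subset n → List (List (Subset n))
chains zero    S = (S ∷ []) ∷ []
chains (suc k) S = concatMap (λ T → map (S ∷_) (chains k T)) (minors S)

_∈ᶜ?_ : (A : Subset n) (c : List (Subset n)) → Dec (A ∈ c)
_∈ᶜ?_ = DecPropositional._∈?_ _≟ˢ_

∑-chains : ∀ k (S : Subset n) (f : List (Subset n) → ℕ) →
  ∑ (chains (suc k) S) f ≡ ∑ (minors S) (λ T → ∑ (chains k T) (λ c → f (S ∷ c)))
∑-chains k S f = trans (∑-concatMap _ (minors S) f) (∑-cong (minors S) λ {T} _ → ∑-map (S ∷_) (chains k T) f)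

chains⁻ : ∀ k (S : Subset n) {c} → c ∈ chains (suc k) S →
  ∃ λ T → ∃ λ c′ → T ∈ minors S × c′ ∈ chains k T × c ≡ S ∷ c′
chains⁻ k S c∈ with cs , c∈cs , cs∈ ← ∈-concat⁻′ (map (λ T → map (S ∷_) (chains k T)) (minors S)) c∈
  with T , T∈ , refl ← ∈-map⁻ _ cs∈ with c′ , c′∈ , eq ← ∈-map⁻ _ c∈cs = T , c′ , T∈ , c′∈ , eq

top∈chain : ∀ k (S : Subset n) {c} → c ∈ chains k S → S ∈ c
top∈chain zero    S (here refl) = here refl
top∈chain (suc k) S c∈ with _ , _ , _ , _ , refl ← chains⁻ k S c∈ = here refl

∈chain⇒⊆ : ∀ k (S : Subset n) {c A} → c ∈ chains k S → A ∈ c → A ⊆ S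
∈chain⇒⊆ zero    S (here refl) (here refl) = ⊆-refl
∈chain⇒⊆ (suc k) S c∈ A∈ with T , c′ , T∈ , c′∈ , refl ← chains⁻ k S c∈ with A∈
... | here refl = ⊆-refl
... | there A∈′ = ⊆-trans (∈chain⇒⊆ k T c′∈ A∈′) (minors-⊆ S T∈)

chain-total : ∀ k (S : Subset n) {c A B} → c ∈ chains k S → A ∈ c → B ∈ c → A ⊆ B ⊎ B ⊆ A
chain-total zero    S (here refl) (here refl) (here refl) = inj₁ ⊆-refl
chain-total (suc k) S c∈ A∈ B∈ with T , c′ , T∈ , c′∈ , refl ← chains⁻ k S c∈ with A∈ | B∈
... | here refl | _         = inj₂ (∈chain⇒⊆ (suc k) S c∈ B∈)
... | there _   | here refl = inj₁ (∈chain⇒⊆ (suc k) S c∈ A∈)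
... | there A∈′ | there B∈′ = chain-total k T c′∈ A∈′ B∈′

length-chains : ∀ k (S : Subset n) → ∣ S ∣ ≡ k → ∑ (chains k S) (λ _ → 1) ≡ k !
length-chains zero    S e = refl
length-chains (suc k) S e = begin
  ∑ (chains (suc k) S) (λ _ → 1)                ≡⟨ ∑-chains k S _ ⟩
  ∑ (minors S) (λ T → ∑ (chains k T) (λ _ → 1)) ≡⟨ ∑-cong (minors S) (λ {T} T∈ → length-chains k T (suc-injective (trans (minors-size S T∈) e))) ⟩
  ∑ (minors S) (λ _ → k !)                      ≡⟨ ∑-const (minors S) (k !) ⟩
  length (minors S) * k !                       ≡⟨ cong (_* k !) (trans (length-minors S) e) ⟩
  suc k * k !                                   ∎
  where open ≡-Reasoning

-- A chain from S through M splits at M, and h sees only the part below M.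
∑-through : ∀ k {S M : Subset n} (h : List (Subset n) → ℕ) →
  (∀ {T} c → M ⊂ T → h (T ∷ c) ≡ h c) → M ⊆ S → ∣ S ∣ ≡ k + ∣ M ∣ →
  ∑ (chains ∣ S ∣ S) (λ c → 𝟙 (M ∈ᶜ? c) * h c) ≡ k ! * ∑ (chains ∣ M ∣ M) h
∑-through zero {S} {M} h local M⊆S e with refl ← ⊆∧∣≡∣⇒≡ M⊆S (sym e) =
  trans (∑-cong (chains ∣ S ∣ S) λ {c} c∈ → cong (_* h c) (𝟙-yes (S ∈ᶜ? c) (top∈chain ∣ S ∣ S c∈)))
        (trans (∑-*ˡ (chains ∣ S ∣ S) 1 h) refl)
∑-through (suc k) {S} {M} h local M⊆S e rewrite e = begin
  ∑ (chains (suc (k + ∣ M ∣)) S) (λ c → 𝟙 (M ∈ᶜ? c) * h c)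
    ≡⟨ ∑-chains (k + ∣ M ∣) S _ ⟩
  ∑ (minors S) (λ T → ∑ (chains (k + ∣ M ∣) T) (λ c → 𝟙 (M ∈ᶜ? (S ∷ c)) * h (S ∷ c)))
    ≡⟨ ∑-cong (minors S) below ⟩
  ∑ (minors S) (λ T → 𝟙 (M ⊆? T) * (k ! * X))
    ≡⟨ ∑-*ʳ (minors S) (k ! * X) _ ⟩
  ∑ (minors S) (λ T → 𝟙 (M ⊆? T)) * (k ! * X)
    ≡⟨ cong (_* (k ! * X)) (+-cancelˡ-≡ ∣ M ∣ _ _ (trans (count-minors-⊇ M⊆S) (trans e (+-comm (suc k) ∣ M ∣)))) ⟩
  suc k * (k ! * X)
    ≡⟨ sym (*-assoc (suc k) (k !) X) ⟩
  suc k ! * X ∎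
  where
  open ≡-Reasoning
  X = ∑ (chains ∣ M ∣ M) h
  M≢S : M ≢ S
  M≢S refl = m≢1+n+m ∣ M ∣ e
  below : ∀ {T} → T ∈ minors S →
    ∑ (chains (k + ∣ M ∣) T) (λ c → 𝟙 (M ∈ᶜ? (S ∷ c)) * h (S ∷ c)) ≡ 𝟙 (M ⊆? T) * (k ! * X)
  below {T} T∈ = begin
    ∑ (chains (k + ∣ M ∣) T) (λ c → 𝟙 (M ∈ᶜ? (S ∷ c)) * h (S ∷ c))
      ≡⟨ ∑-cong (chains (k + ∣ M ∣) T) (λ {c} _ → cong₂ _*_
           (𝟙-cong (M ∈ᶜ? (S ∷ c)) (M ∈ᶜ? c) (λ { (here M≡S) → contradiction M≡S M≢S ; (there M∈) → M∈ }) there)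
           (local c (⊆∧≢⇒⊂ M⊆S M≢S))) ⟩
    ∑ (chains (k + ∣ M ∣) T) (λ c → 𝟙 (M ∈ᶜ? c) * h c)
      ≡⟨ split (M ⊆? T) ⟩
    𝟙 (M ⊆? T) * (k ! * X) ∎
    where
    ∣T∣ : ∣ T ∣ ≡ k + ∣ M ∣
    ∣T∣ = suc-injective (trans (minors-size S T∈) e)
    split : (d : Dec (M ⊆ T)) → ∑ (chains (k + ∣ M ∣) T) (λ c → 𝟙 (M ∈ᶜ? c) * h c) ≡ 𝟙 d * (k ! * X)
    split (yes M⊆T) = trans (subst (λ j → ∑ (chains j T) (λ c → 𝟙 (M ∈ᶜ? c) * h c) ≡ k ! * X) ∣T∣
                              (∑-through k h local M⊆T ∣T∣))
                            (sym (*-identityˡ (k ! * X)))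
    split (no M⊈T) = trans (∑-cong (chains (k + ∣ M ∣) T) λ {c} c∈ →
                              cong (_* h c) (𝟙-no (M ∈ᶜ? c) (M⊈T ∘ ∈chain⇒⊆ (k + ∣ M ∣) T c∈)))
                           (∑-0 (chains (k + ∣ M ∣) T))

-- A chain from `S` through `A` deletes the elements outside `A` first, in any order, and then those
-- of `A`. This is `∑-through` with `h` constantly 1.
count-through : ∀ {A S : Subset n} → A ⊆ S →
  ∑ (chains ∣ S ∣ S) (λ c → 𝟙 (A ∈ᶜ? c)) ≡ (∣ S ∣ ∸ ∣ A ∣) ! * ∣ A ∣ !
count-through {A = A} {S} A⊆S = begin
  ∑ (chains ∣ S ∣ S) (λ c → 𝟙 (A ∈ᶜ? c))
    ≡⟨ ∑-cong (chains ∣ S ∣ S) (λ _ → sym (*-identityʳ _)) ⟩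
  ∑ (chains ∣ S ∣ S) (λ c → 𝟙 (A ∈ᶜ? c) * 1)
    ≡⟨ ∑-through (∣ S ∣ ∸ ∣ A ∣) (λ _ → 1) (λ _ _ → refl) A⊆S (sym (m∸n+n≡m (p⊆q⇒∣p∣≤∣q∣ A⊆S))) ⟩
  (∣ S ∣ ∸ ∣ A ∣) ! * ∑ (chains ∣ A ∣ A) (λ _ → 1)
    ≡⟨ cong ((∣ S ∣ ∸ ∣ A ∣) ! *_) (length-chains ∣ A ∣ A refl) ⟩
  (∣ S ∣ ∸ ∣ A ∣) ! * ∣ A ∣ ! ∎
  where open ≡-Reasoning

-- Here `h` in `∑-through` is the indicator of `A`. It ignores the part of the chain above `M`,
-- since a set strictly containing `M` is too large to be `A`.
count-through₂ : ∀ {A M S : Subset n} → A ⊆ M → M ⊆ S →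
  ∑ (chains ∣ S ∣ S) (λ c → 𝟙 (M ∈ᶜ? c) * 𝟙 (A ∈ᶜ? c)) ≡ (∣ S ∣ ∸ ∣ M ∣) ! * ((∣ M ∣ ∸ ∣ A ∣) ! * ∣ A ∣ !)
count-through₂ {A = A} {M} {S} A⊆M M⊆S = trans
  (∑-through (∣ S ∣ ∸ ∣ M ∣) (λ c → 𝟙 (A ∈ᶜ? c)) local M⊆S (sym (m∸n+n≡m (p⊆q⇒∣p∣≤∣q∣ M⊆S))))
  (cong ((∣ S ∣ ∸ ∣ M ∣) ! *_) (count-through A⊆M))
  where
  local : ∀ {T} c → M ⊂ T → 𝟙 (A ∈ᶜ? (T ∷ c)) ≡ 𝟙 (A ∈ᶜ? c)
  local {T} c M⊂T = 𝟙-cong (A ∈ᶜ? (T ∷ c)) (A ∈ᶜ? c)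
    (λ { (here A≡T) → contradiction (≤-trans (p⊂q⇒∣p∣<∣q∣ M⊂T) (≤-reflexive (cong ∣_∣ (sym A≡T)))) (≤⇒≯ (p⊆q⇒∣p∣≤∣q∣ A⊆M))
       ; (there A∈) → A∈ }) there

-- Sums of reciprocals of binomial coefficients

interval : ℕ → ℕ → List ℕ
interval i zero    = []
interval i (suc j) = i ∷ interval (suc i) j

∈-interval : ∀ {d} i j → i ≤ d → d < i + j → d ∈ interval i j
∈-interval i zero    i≤d d<i = contradiction (≤-trans d<i (≤-reflexive (+-identityʳ i))) (≤⇒≯ i≤d)
∈-interval {d} i (suc j) i≤d d<i+j with i ≟ d
... | yes refl = here refl
... | no i≢d   = there (∈-interval (suc i) j (≤∧≢⇒< i≤d i≢d) (≤-trans d<i+j (≤-reflexive (+-suc i j))))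

-- The total k = i + j is constant along the recursion, so this is the sum of (k - d)! d! over i ≤ d
-- < k; the term d = k is left out.
facSum : ℕ → ℕ → ℕ
facSum i zero    = 0
facSum i (suc j) = suc j ! * i ! + facSum (suc i) j

∑-interval : ∀ i j → ∑ (interval i j) (λ d → (i + j ∸ d) ! * d !) ≡ facSum i j
∑-interval i zero    = refl
∑-interval i (suc j) = cong₂ _+_ (cong (λ k → k ! * i !) (m+n∸m≡n i (suc j)))
  (trans (∑-cong (interval (suc i) j) (λ {d} _ → cong (λ k → (k ∸ d) ! * d !) (+-suc i j))) (∑-interval (suc i) j))

-- Sums (d+1)!(k-d)! + d!(k+1-d)! = (k+2) d!(k-d)! over d, where k = i + j.
facSum-step : ∀ i j → facSum (suc i) j + facSum i (suc j) ≡ (2 + i + j) * facSum i j + (i + j) !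
facSum-step i zero rewrite +-identityʳ i = base i (i !)
  where
  base : ∀ i b → 0 + (1 * b + 0) ≡ (2 + i) * 0 + b
  base = solve-∀
facSum-step i (suc j) rewrite +-suc i j =
  step i j (suc j !) (i !) (facSum (2 + i) j) (facSum (suc i) (suc j)) (facSum (suc i) j) (suc (i + j) !) (facSum-step (suc i) j)
  where
  regroupˡ : ∀ i j a b x y → a * (suc i * b) + x + ((2 + j) * a * b + y) ≡ (3 + i + j) * (a * b) + (x + y)
  regroupˡ = solve-∀
  regroupʳ : ∀ i j a b z f → (3 + i + j) * (a * b) + ((3 + i + j) * z + f) ≡ (3 + i + j) * (a * b + z) + f
  regroupʳ = solve-∀
  step : ∀ i j a b x y z f → x + y ≡ (3 + i + j) * z + f →
    a * (suc i * b) + x + ((2 + j) * a * b + y) ≡ (3 + i + j) * (a * b + z) + f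
  step i j a b x y z f e = trans (regroupˡ i j a b x y)
    (trans (cong ((3 + i + j) * (a * b) +_) e) (regroupʳ i j a b z f))

interiorSum : ℕ → ℕ
interiorSum m = facSum 1 (m ∸ 1)

-- Percentages: interiorSum m / m! = ∑_{0<d<m} 1/(m C d) ≤ β m / 100.
β : ℕ → ℕ
β 0 = 0
β 1 = 0
β 2 = 50
β 3 = 67
β 4 = 67
β 5 = 60
β 6 = 52
β 7 = 44
β 8 = 38
β (suc (suc (suc (suc (suc (suc (suc (suc (suc _))))))))) = 32

-- Write S for `interiorSum` and m for 9 + t. `facSum-step` with i = 1 gives 2 S(m+1) = (m+2) S(m) +
-- 2 m!, because the two sums on its left differ only by the first term m!. This recurrence
-- preserves S(m) / m! ≤ 32/100; the base m = 9 is evaluated.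
interiorSum-tail : ∀ t → 100 * interiorSum (9 + t) ≤ 32 * (9 + t) !
interiorSum-tail zero    = ≤ᵇ⇒≤ _ _ _
interiorSum-tail (suc t) = step t ((9 + t) !) (facSum 1 (8 + t)) (facSum 1 (9 + t)) (facSum 2 (8 + t))
  (interiorSum-tail t) (facSum-step 1 (8 + t)) refl
  where
  step : ∀ t f x y s → 100 * x ≤ 32 * f → s + y ≡ (11 + t) * x + f → y ≡ f * 1 + s →
    100 * y ≤ 32 * ((10 + t) * f)
  step t f x y s ih e y≡ = *-cancelˡ-≤ 2 (begin
    2 * (100 * y)                         ≡⟨ double y ⟩
    100 * (y + y)                         ≡⟨ cong (λ z → 100 * (z + y)) y≡ ⟩
    100 * (f * 1 + s + y)                 ≡⟨ regroup f s y ⟩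
    100 * f + 100 * (s + y)               ≡⟨ cong (λ z → 100 * f + 100 * z) e ⟩
    100 * f + 100 * ((11 + t) * x + f)    ≡⟨ isolate t f x ⟩
    200 * f + (11 + t) * (100 * x)        ≤⟨ +-monoʳ-≤ (200 * f) (*-monoʳ-≤ (11 + t) ih) ⟩
    -- The slack is 64 (10 + t) - 200 - 32 (11 + t) = 88 + 32 t.
    200 * f + (11 + t) * (32 * f)         ≤⟨ m≤m+n _ ((88 + 32 * t) * f) ⟩
    200 * f + (11 + t) * (32 * f) + (88 + 32 * t) * f ≡⟨ collect t f ⟩
    2 * (32 * ((10 + t) * f))             ∎)
    where
    open ≤-Reasoning
    double : ∀ y → 2 * (100 * y) ≡ 100 * (y + y)
    double = solve-∀
    regroup : ∀ f s y → 100 * (f * 1 + s + y) ≡ 100 * f + 100 * (s + y)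
    regroup = solve-∀
    isolate : ∀ t f x → 100 * f + 100 * ((11 + t) * x + f) ≡ 200 * f + (11 + t) * (100 * x)
    isolate = solve-∀
    collect : ∀ t f → 200 * f + (11 + t) * (32 * f) + (88 + 32 * t) * f ≡ 2 * (32 * ((10 + t) * f))
    collect = solve-∀

interiorSum≤β : ∀ m → 100 * interiorSum m ≤ β m * m !
interiorSum≤β 0 = ≤ᵇ⇒≤ _ _ _
interiorSum≤β 1 = ≤ᵇ⇒≤ _ _ _
interiorSum≤β 2 = ≤ᵇ⇒≤ _ _ _
interiorSum≤β 3 = ≤ᵇ⇒≤ _ _ _
interiorSum≤β 4 = ≤ᵇ⇒≤ _ _ _
interiorSum≤β 5 = ≤ᵇ⇒≤ _ _ _
interiorSum≤β 6 = ≤ᵇ⇒≤ _ _ _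
interiorSum≤β 7 = ≤ᵇ⇒≤ _ _ _
interiorSum≤β 8 = ≤ᵇ⇒≤ _ _ _
interiorSum≤β (suc (suc (suc (suc (suc (suc (suc (suc (suc t))))))))) = interiorSum-tail t

β-large : ∀ {m} → 9 ≤ m → β m ≡ 32
β-large {m} 9≤m rewrite sym (m+[n∸m]≡n 9≤m) = refl

β≤67 : ∀ m → β m ≤ 67
β≤67 m with m <? 9
... | yes m<9 = from-yes (allUpTo? (λ m → β m ≤? 67) 9) m<9
... | no m≮9  = ≤-trans (≤-reflexive (β-large (≮⇒≥ m≮9))) (≤ᵇ⇒≤ _ _ _)

-- If one argument is at least 9, the bound is 32 + 67 = 99; the remaining pairs are checked by
-- computation. The value 13 matters: 4 and 8 already give 67 + 38 = 105, and a total below 100 is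
-- what leaves a gain.
β-sum : ∀ m k → 13 ≤ m + k → β m + β k ≤ 99
β-sum m k 13≤m+k with m <? 9 | k <? 9
... | no m≮9  | _       = +-mono-≤ (≤-reflexive (β-large (≮⇒≥ m≮9))) (β≤67 k)
... | yes _   | no k≮9  = +-mono-≤ (β≤67 m) (≤-reflexive (β-large (≮⇒≥ k≮9)))
... | yes m<9 | yes k<9 = from-yes (allUpTo? (λ m → allUpTo? (λ k → (13 ≤? m + k) →-dec (β m + β k ≤? 99)) 9) 9) m<9 k<9 13≤m+k

-- Counting along chains

𝟙-×-dec : {P Q : Set} (d : Dec P) (e : Dec Q) → 𝟙 (d ×-dec e) ≡ 𝟙 d * 𝟙 e
𝟙-×-dec (yes _) (yes _) = refl
𝟙-×-dec (yes _) (no _)  = refl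
𝟙-×-dec (no _)  _       = refl

⊂-trichotomy : ∀ {A B : Subset n} → A ⊆ B ⊎ B ⊆ A → A ≢ B → A ⊂ B ⊎ B ⊂ A
⊂-trichotomy (inj₁ A⊆B) A≢B = inj₁ (⊆∧≢⇒⊂ A⊆B A≢B)
⊂-trichotomy (inj₂ B⊆A) A≢B = inj₂ (⊆∧≢⇒⊂ B⊆A (A≢B ∘ sym))

-- In each summand the larger set is tested first, to match count-through₂.
pairIn : List (Subset n) → Subset n → Subset n → ℕ
pairIn c M A = 𝟙 (A ⊂? M) * (𝟙 (M ∈ᶜ? c) * 𝟙 (A ∈ᶜ? c)) + 𝟙 (M ⊂? A) * (𝟙 (A ∈ᶜ? c) * 𝟙 (M ∈ᶜ? c))

-- For a chain `c`, `X` counts the members of `L` on it, `R` those satisfying `Q`, and `P` the pairs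
-- of a `Q`-member and another member, both on `c`. `Q` may hold for more sets than those lying
-- between two members of `L`.
module _ {L c : List (Subset n)} {Q : Subset n → Set} (Q? : Decidable Q) (uniq : Unique L)
  (inner⇒Q : ∀ {A M B} → A ∈ L → M ∈ L → B ∈ L → A ⊂ M → M ⊂ B → Q M)
  (total : ∀ {A B} → A ∈ c → B ∈ c → A ⊆ B ⊎ B ⊆ A) where

  private
    X R P : ℕ
    X = ∑ L (λ A → 𝟙 (A ∈ᶜ? c))
    R = ∑ L (λ M → 𝟙 (Q? M) * 𝟙 (M ∈ᶜ? c))
    P = ∑ L (λ M → 𝟙 (Q? M) * ∑ L (pairIn c M))

    -- On a chain every other member is strictly above or below `M`, hence counted by `pairIn`. The
    -- last summand accounts for `M` itself, which occurs only once in `L`.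
    comparable≤ : ∀ {M} → M ∈ L → 𝟙 (M ∈ᶜ? c) * X ≤ ∑ L (pairIn c M) + 𝟙 (M ∈ᶜ? c)
    comparable≤ {M} M∈L with M ∈ᶜ? c
    ... | no _    = z≤n
    ... | yes M∈c = begin
      1 * X                                          ≡⟨ *-identityˡ X ⟩
      X                                              ≤⟨ ∑-mono L each ⟩
      ∑ L (λ A → pair A + 𝟙 (A ≟ˢ M))                ≡⟨ ∑-+ L pair (λ A → 𝟙 (A ≟ˢ M)) ⟩
      ∑ L pair + ∑ L (λ A → 𝟙 (A ≟ˢ M))              ≤⟨ +-monoʳ-≤ (∑ L pair) (∑-𝟙≤1 (_≟ˢ M) uniq λ { _ _ refl refl → refl }) ⟩
      ∑ L pair + 1 ∎
      where
      open ≤-Reasoning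
      pair : Subset n → ℕ
      pair A = 𝟙 (A ⊂? M) * (1 * 𝟙 (A ∈ᶜ? c)) + 𝟙 (M ⊂? A) * (𝟙 (A ∈ᶜ? c) * 1)
      each : ∀ {A} → A ∈ L → 𝟙 (A ∈ᶜ? c) ≤ pair A + 𝟙 (A ≟ˢ M)
      each {A} A∈L with A ∈ᶜ? c
      ... | no _ = z≤n
      ... | yes A∈c with A ≟ˢ M
      ...   | yes _  = m≤n+m 1 _
      ...   | no A≢M with A ⊂? M | M ⊂? A
      ...     | yes _  | _      = s≤s z≤n
      ...     | no _   | yes _  = s≤s z≤n
      ...     | no A⊄M | no M⊄A with ⊂-trichotomy (total A∈c M∈c) A≢M
      ...       | inj₁ A⊂M = contradiction A⊂M A⊄M
      ...       | inj₂ M⊂A = contradiction M⊂A M⊄A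

    R*X≤P+R : R * X ≤ P + R
    R*X≤P+R = begin
      R * X ≡⟨ sym (∑-*ʳ L X _) ⟩
      ∑ L (λ M → 𝟙 (Q? M) * 𝟙 (M ∈ᶜ? c) * X)
        ≡⟨ ∑-cong L (λ {M} _ → *-assoc (𝟙 (Q? M)) _ X) ⟩
      ∑ L (λ M → 𝟙 (Q? M) * (𝟙 (M ∈ᶜ? c) * X))
        ≤⟨ ∑-mono L (λ {M} M∈ → *-monoʳ-≤ (𝟙 (Q? M)) (comparable≤ M∈)) ⟩
      ∑ L (λ M → 𝟙 (Q? M) * (∑ L (pairIn c M) + 𝟙 (M ∈ᶜ? c)))
        ≡⟨ ∑-cong L (λ {M} _ → *-distribˡ-+ (𝟙 (Q? M)) _ _) ⟩
      ∑ L (λ M → 𝟙 (Q? M) * ∑ L (pairIn c M) + 𝟙 (Q? M) * 𝟙 (M ∈ᶜ? c))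
        ≡⟨ ∑-+ L _ _ ⟩
      P + R ∎
      where open ≤-Reasoning

    R≤X : R ≤ X
    R≤X = ∑-mono L λ {M} _ → ≤-trans (*-monoˡ-≤ (𝟙 (M ∈ᶜ? c)) (𝟙≤1 (Q? M))) (≤-reflexive (*-identityˡ _))

    Q∈c⇒1≤R : ∀ {M} → M ∈ L → M ∈ c → Q M → 1 ≤ R
    Q∈c⇒1≤R {M} M∈L M∈c q = ≤-trans
      (≤-reflexive (sym (cong₂ _*_ (𝟙-yes (Q? M) q) (𝟙-yes (M ∈ᶜ? c) M∈c))))
      (f[x]≤∑ (λ M → 𝟙 (Q? M) * 𝟙 (M ∈ᶜ? c)) M∈L)

    -- Three distinct sets on a chain are linearly ordered, and the middle one satisfies `Q` by
    -- `inner⇒Q`.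
    three⇒1≤R : 3 ≤ X → 1 ≤ R
    three⇒1≤R 3≤X = go (filter (_∈ᶜ? c) L) (Unique.filter⁺ (_∈ᶜ? c) uniq) (∈-filter⁻ (_∈ᶜ? c))
      (≤-trans 3≤X (≤-reflexive (begin
        X                                   ≡⟨ ∑-cong L (λ _ → sym (*-identityʳ _)) ⟩
        ∑ L (λ A → 𝟙 (A ∈ᶜ? c) * 1)         ≡⟨ sym (∑-filter (_∈ᶜ? c) L (λ _ → 1)) ⟩
        ∑ (filter (_∈ᶜ? c) L) (λ _ → 1)     ≡⟨ trans (∑-const (filter (_∈ᶜ? c) L) 1) (*-identityʳ _) ⟩
        length (filter (_∈ᶜ? c) L)          ∎)))
      where
      open ≡-Reasoning
      go : ∀ K → Unique K → (∀ {A} → A ∈ K → A ∈ L × A ∈ c) → 3 ≤ length K → 1 ≤ R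
      go (A ∷ B ∷ [])     _ _ (s≤s (s≤s ()))
      go (A ∷ B ∷ C ∷ _) ((A≢B ∷ A≢C ∷ _) ∷ (B≢C ∷ _) ∷ _) K⊆ _
        with A∈L , A∈c ← K⊆ (here refl) | B∈L , B∈c ← K⊆ (there (here refl)) | C∈L , C∈c ← K⊆ (there (there (here refl)))
        with ⊂-trichotomy (total A∈c B∈c) A≢B | ⊂-trichotomy (total A∈c C∈c) A≢C | ⊂-trichotomy (total B∈c C∈c) B≢C
      ... | inj₁ A⊂B | _        | inj₁ B⊂C = Q∈c⇒1≤R B∈L B∈c (inner⇒Q A∈L B∈L C∈L A⊂B B⊂C)
      ... | inj₁ A⊂B | inj₁ A⊂C | inj₂ C⊂B = Q∈c⇒1≤R C∈L C∈c (inner⇒Q A∈L C∈L B∈L A⊂C C⊂B)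
      ... | inj₁ A⊂B | inj₂ C⊂A | _        = Q∈c⇒1≤R A∈L A∈c (inner⇒Q C∈L A∈L B∈L C⊂A A⊂B)
      ... | inj₂ B⊂A | inj₁ A⊂C | _        = Q∈c⇒1≤R A∈L A∈c (inner⇒Q B∈L A∈L C∈L B⊂A A⊂C)
      ... | inj₂ B⊂A | inj₂ C⊂A | inj₁ B⊂C = Q∈c⇒1≤R C∈L C∈c (inner⇒Q B∈L C∈L A∈L B⊂C C⊂A)
      ... | inj₂ B⊂A | _        | inj₂ C⊂B = Q∈c⇒1≤R B∈L B∈c (inner⇒Q C∈L B∈L A∈L C⊂B B⊂A)

    -- The last hypothesis says p - r ≥ r (x - 2), and r (x - 2) ≥ x - 2 when x = 2 or r ≥ 1. For x
    -- < 2 the number x - 2 is negative, and r ≤ x is used instead.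
    arithmetic : ∀ x r p → r ≤ x → (3 ≤ x → 1 ≤ r) → r * x ≤ p + r → x + r ≤ 2 + p
    arithmetic 0 0 p _ _ _ = z≤n
    arithmetic 1 r p r≤1 _ _ = ≤-trans (s≤s r≤1) (m≤m+n 2 p)
    arithmetic (suc (suc x)) r p _ h rx≤ = +-cancelʳ-≤ r _ _ (begin
      2 + x + r + r          ≡⟨ regroup x r ⟩
      2 + (x + r * 2)        ≤⟨ +-monoʳ-≤ 2 (+-monoˡ-≤ (r * 2) (x≤r*x x h)) ⟩
      2 + (r * x + r * 2)    ≡⟨ factor x r ⟩
      2 + r * (2 + x)        ≤⟨ +-monoʳ-≤ 2 rx≤ ⟩
      2 + (p + r)            ∎)
      where
      open ≤-Reasoning
      regroup : ∀ x r → 2 + x + r + r ≡ 2 + (x + r * 2)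
      regroup = solve-∀
      factor : ∀ x r → 2 + (r * x + r * 2) ≡ 2 + r * (2 + x)
      factor = solve-∀
      x≤r*x : ∀ x → (3 ≤ 2 + x → 1 ≤ r) → x ≤ r * x
      x≤r*x zero    _ = z≤n
      x≤r*x (suc x) h = ≤-trans (≤-reflexive (sym (*-identityˡ (suc x)))) (*-monoˡ-≤ (suc x) (h (s≤s (s≤s (s≤s z≤n)))))

  chain-bound : X + R ≤ 2 + P
  chain-bound = arithmetic X R P R≤X three⇒1≤R R*X≤P+R

-- Averaging over all maximal chains.

weight : Subset n → ℕ
weight {n} A = (n ∸ ∣ A ∣) ! * ∣ A ∣ !

maxChains : ∀ n → List (List (Subset n))
maxChains n = chains ∣ ⊤ {n} ∣ ⊤

count-maxChains : ∀ n → ∑ (maxChains n) (λ _ → 1) ≡ n !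
count-maxChains n = trans (length-chains ∣ ⊤ {n} ∣ ⊤ refl) (cong _! (∣⊤∣≡n n))

count-∋ : (A : Subset n) → ∑ (maxChains n) (λ c → 𝟙 (A ∈ᶜ? c)) ≡ weight A
count-∋ {n} A = trans (count-through {A = A} {⊤} ⊆⊤) (cong (λ k → (k ∸ ∣ A ∣) ! * ∣ A ∣ !) (∣⊤∣≡n n))

count-⊂ : (A M : Subset n) → ∑ (maxChains n) (λ c → 𝟙 (A ⊂? M) * (𝟙 (M ∈ᶜ? c) * 𝟙 (A ∈ᶜ? c))) ≡
  𝟙 (A ⊂? M) * ((n ∸ ∣ M ∣) ! * ((∣ M ∣ ∸ ∣ A ∣) ! * ∣ A ∣ !))
count-⊂ {n} A M with A ⊂? M
... | no _    = ∑-0 (maxChains n)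
... | yes A⊂M = trans (∑-*ˡ (maxChains n) 1 _) (cong (1 *_)
  (trans (count-through₂ (p⊂q⇒p⊆q A⊂M) ⊆⊤) (cong (λ k → (k ∸ ∣ M ∣) ! * ((∣ M ∣ ∸ ∣ A ∣) ! * ∣ A ∣ !)) (∣⊤∣≡n n))))

-- A maximal chain meets an antichain at most once, so the sets of chains through its members are
-- disjoint. Since `weight A` is n! divided by the binomial coefficient of n and `∣ A ∣`, this is
-- the LYM inequality multiplied by n!.
lym : {L : List (Subset n)} {P : Subset n → Set} (P? : Decidable P) → Unique L →
  (∀ {A B} → A ∈ L → B ∈ L → P A → P B → ¬ A ⊂ B) → ∑ L (λ A → 𝟙 (P? A) * weight A) ≤ n !
lym {n} {L} P? uniq anti = begin
  ∑ L (λ A → 𝟙 (P? A) * weight A)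
    ≡⟨ ∑-cong L (λ {A} _ → trans (cong (𝟙 (P? A) *_) (sym (count-∋ A))) (sym (∑-*ˡ 𝒞 (𝟙 (P? A)) _))) ⟩
  ∑ L (λ A → ∑ 𝒞 (λ c → 𝟙 (P? A) * 𝟙 (A ∈ᶜ? c)))
    ≡⟨ ∑-swap L 𝒞 _ ⟩
  ∑ 𝒞 (λ c → ∑ L (λ A → 𝟙 (P? A) * 𝟙 (A ∈ᶜ? c)))
    ≤⟨ ∑-mono 𝒞 (λ {c} c∈ → ≤-trans (≤-reflexive (∑-cong L (λ {A} _ → sym (𝟙-×-dec (P? A) (A ∈ᶜ? c))))) (atMostOne c∈)) ⟩
  ∑ 𝒞 (λ _ → 1)
    ≡⟨ count-maxChains n ⟩
  n ! ∎
  where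
  open ≤-Reasoning
  𝒞 = maxChains n
  atMostOne : ∀ {c} → c ∈ 𝒞 → ∑ L (λ A → 𝟙 (P? A ×-dec (A ∈ᶜ? c))) ≤ 1
  atMostOne {c} c∈ = ∑-𝟙≤1 (λ A → P? A ×-dec (A ∈ᶜ? c)) uniq equal
    where
    equal : ∀ {A B} → A ∈ L → B ∈ L → _ → _ → A ≡ B
    equal {A} {B} A∈ B∈ (pA , A∈c) (pB , B∈c) with A ≟ˢ B
    ... | yes A≡B = A≡B
    ... | no A≢B with ⊂-trichotomy (chain-total ∣ ⊤ {n} ∣ ⊤ c∈ A∈c B∈c) A≢B
    ...   | inj₁ A⊂B = contradiction A⊂B (anti A∈ B∈ pA pB)
    ...   | inj₂ B⊂A = contradiction B⊂A (anti B∈ A∈ pB pA)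

module _ {L : List (Subset n)} {Q : Subset n → Set} (Q? : Decidable Q) (13≤n : 13 ≤ n) (uniq : Unique L)
  (proper : ∀ {A} → A ∈ L → 0 < ∣ A ∣ × ∣ A ∣ < n)
  (inner⇒Q : ∀ {A M B} → A ∈ L → M ∈ L → B ∈ L → A ⊂ M → M ⊂ B → Q M)
  (below-inj : ∀ {M A B} → M ∈ L → Q M → A ∈ L → B ∈ L → A ⊂ M → B ⊂ M → ∣ A ∣ ≡ ∣ B ∣ → A ≡ B)
  (above-inj : ∀ {M A B} → M ∈ L → Q M → A ∈ L → B ∈ L → M ⊂ A → M ⊂ B → ∣ A ∣ ≡ ∣ B ∣ → A ≡ B) where

  private
    𝒞 = maxChains n

    ∑-interior : ∀ m → 0 < m → ∑ (interval 1 (m ∸ 1)) (λ d → (m ∸ d) ! * d !) ≡ interiorSum m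
    ∑-interior (suc m) _ = ∑-interval 1 m

    ∈-interior : ∀ {d m} → 0 < d → d < m → d ∈ interval 1 (m ∸ 1)
    ∈-interior {d} {suc m} 0<d d<m = ∈-interval 1 m 0<d d<m

    below above : Subset n → Subset n → ℕ
    below M A = 𝟙 (A ⊂? M) * ((n ∸ ∣ M ∣) ! * ((∣ M ∣ ∸ ∣ A ∣) ! * ∣ A ∣ !))
    above M B = 𝟙 (M ⊂? B) * ((n ∸ ∣ B ∣) ! * ((∣ B ∣ ∸ ∣ M ∣) ! * ∣ M ∣ !))

    -- For A ⊂ M, `below M A` counts the maximal chains through both sets. By `below-inj` each size
    -- 0 < d < m occurs at most once among the A, so `∑-inj` applies with size as key.
    ∑-below : ∀ {M} → M ∈ L → Q M → ∑ L (below M) ≤ (n ∸ ∣ M ∣) ! * interiorSum ∣ M ∣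
    ∑-below {M} M∈ q = begin
      ∑ L (below M)
        ≤⟨ ∑-inj (_⊂? M) ∣_∣ (interval 1 (m ∸ 1)) uniq (below-inj M∈ q)
             (λ A∈ A⊂M → ∈-interior (proj₁ (proper A∈)) (p⊂q⇒∣p∣<∣q∣ A⊂M))
             (λ d → (n ∸ m) ! * ((m ∸ d) ! * d !)) ⟩
      ∑ (interval 1 (m ∸ 1)) (λ d → (n ∸ m) ! * ((m ∸ d) ! * d !))
        ≡⟨ ∑-*ˡ (interval 1 (m ∸ 1)) ((n ∸ m) !) _ ⟩
      (n ∸ m) ! * ∑ (interval 1 (m ∸ 1)) (λ d → (m ∸ d) ! * d !)
        ≡⟨ cong ((n ∸ m) ! *_) (∑-interior m (proj₁ (proper M∈))) ⟩
      (n ∸ m) ! * interiorSum m ∎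
      where
      open ≤-Reasoning
      m = ∣ M ∣

    -- This mirrors `∑-below` in the interval from `M` to [n], a Boolean lattice of rank n - m. The
    -- key is therefore the relative size of B over `M`, and `rekey` rewrites n - |B| as (n - m) -
    -- (|B| - m).
    ∑-above : ∀ {M} → M ∈ L → Q M → ∑ L (above M) ≤ interiorSum (n ∸ ∣ M ∣) * ∣ M ∣ !
    ∑-above {M} M∈ q = begin
      ∑ L (above M)
        ≡⟨ ∑-cong L (λ {B} B∈ → rekey B (M ⊂? B)) ⟩
      ∑ L (λ B → 𝟙 (M ⊂? B) * ((n ∸ m ∸ (∣ B ∣ ∸ m)) ! * (∣ B ∣ ∸ m) ! * m !))
        ≤⟨ ∑-inj (M ⊂?_) (λ B → ∣ B ∣ ∸ m) ks uniq
             (λ A∈ B∈ M⊂A M⊂B e → above-inj M∈ q A∈ B∈ M⊂A M⊂B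
               (∸-cancelʳ-≡ (<⇒≤ (p⊂q⇒∣p∣<∣q∣ M⊂A)) (<⇒≤ (p⊂q⇒∣p∣<∣q∣ M⊂B)) e))
             (λ B∈ M⊂B → ∈-interior (m<n⇒0<n∸m (p⊂q⇒∣p∣<∣q∣ M⊂B))
               (∸-monoˡ-< (proj₂ (proper B∈)) (<⇒≤ (p⊂q⇒∣p∣<∣q∣ M⊂B))))
             (λ d → (n ∸ m ∸ d) ! * d ! * m !) ⟩
      ∑ ks (λ d → (n ∸ m ∸ d) ! * d ! * m !)
        ≡⟨ ∑-*ʳ ks (m !) _ ⟩
      ∑ ks (λ d → (n ∸ m ∸ d) ! * d !) * m !
        ≡⟨ cong (_* m !) (∑-interior (n ∸ m) (m<n⇒0<n∸m (proj₂ (proper M∈)))) ⟩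
      interiorSum (n ∸ m) * m ! ∎
      where
      open ≤-Reasoning
      m = ∣ M ∣
      ks = interval 1 (n ∸ m ∸ 1)
      rekey : ∀ B (d : Dec (M ⊂ B)) → 𝟙 d * ((n ∸ ∣ B ∣) ! * ((∣ B ∣ ∸ m) ! * m !)) ≡
        𝟙 d * ((n ∸ m ∸ (∣ B ∣ ∸ m)) ! * (∣ B ∣ ∸ m) ! * m !)
      rekey B (no _)    = refl
      rekey B (yes M⊂B) = cong (1 *_) (trans (sym (*-assoc ((n ∸ ∣ B ∣) !) _ _))
        (cong (λ k → k ! * (∣ B ∣ ∸ m) ! * m !)
          (sym (trans (∸-+-assoc n m (∣ B ∣ ∸ m)) (cong (n ∸_) (m+[n∸m]≡n (<⇒≤ (p⊂q⇒∣p∣<∣q∣ M⊂B))))))))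

    near : Subset n → Subset n → ℕ
    near M A = below M A + above M A

    -- Divided by `weight M`, the sum is the mean number of other members of `L` on a maximal chain
    -- through `M`.
    ∑-near : ∀ {M} → M ∈ L → Q M → 100 * ∑ L (near M) ≤ 99 * weight M
    ∑-near {M} M∈ q = begin
      100 * ∑ L (near M)
        ≡⟨ cong (100 *_) (∑-+ L (below M) (above M)) ⟩
      100 * (∑ L (below M) + ∑ L (above M))
        ≤⟨ *-monoʳ-≤ 100 (+-mono-≤ (∑-below M∈ q) (∑-above M∈ q)) ⟩
      100 * ((n ∸ m) ! * interiorSum m + interiorSum (n ∸ m) * m !)
        ≡⟨ distribute ((n ∸ m) !) (interiorSum m) (interiorSum (n ∸ m)) (m !) ⟩
      (n ∸ m) ! * (100 * interiorSum m) + 100 * interiorSum (n ∸ m) * m !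
        ≤⟨ +-mono-≤ (*-monoʳ-≤ ((n ∸ m) !) (interiorSum≤β m)) (*-monoˡ-≤ (m !) (interiorSum≤β (n ∸ m))) ⟩
      (n ∸ m) ! * (β m * m !) + β (n ∸ m) * (n ∸ m) ! * m !
        ≡⟨ collect ((n ∸ m) !) (β m) (β (n ∸ m)) (m !) ⟩
      (β m + β (n ∸ m)) * weight M
        ≤⟨ *-monoˡ-≤ (weight M) (β-sum m (n ∸ m) (≤-trans 13≤n (≤-reflexive (sym (m+[n∸m]≡n (∣p∣≤n M)))))) ⟩
      99 * weight M ∎
      where
      open ≤-Reasoning
      m = ∣ M ∣
      distribute : ∀ a x y b → 100 * (a * x + y * b) ≡ a * (100 * x) + 100 * y * b
      distribute = solve-∀
      collect : ∀ a x y b → a * (x * b) + y * a * b ≡ (x + y) * (a * b)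
      collect = solve-∀

    count-pairIn : ∀ M A → ∑ 𝒞 (λ c → pairIn c M A) ≡ near M A
    count-pairIn M A = trans (∑-+ 𝒞 _ _) (cong₂ _+_ (count-⊂ A M) (count-⊂ M A))

    V R P : ℕ
    V = ∑ L weight
    R = ∑ L (λ M → 𝟙 (Q? M) * weight M)
    P = ∑ L (λ M → 𝟙 (Q? M) * ∑ L (near M))

    -- This is `chain-bound` summed over all maximal chains. After exchanging sums, `V`, `R` and `P`
    -- are the totals of the quantities of the same role for a single chain.
    V+R≤ : V + R ≤ n ! * 2 + P
    V+R≤ = begin
      V + R
        ≡⟨ cong₂ _+_ V≡ R≡ ⟩
      ∑ 𝒞 (λ c → ∑ L (λ A → 𝟙 (A ∈ᶜ? c))) + ∑ 𝒞 (λ c → ∑ L (λ M → 𝟙 (Q? M) * 𝟙 (M ∈ᶜ? c)))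
        ≡⟨ sym (∑-+ 𝒞 _ _) ⟩
      ∑ 𝒞 (λ c → ∑ L (λ A → 𝟙 (A ∈ᶜ? c)) + ∑ L (λ M → 𝟙 (Q? M) * 𝟙 (M ∈ᶜ? c)))
        ≤⟨ ∑-mono 𝒞 (λ {c} c∈ → chain-bound Q? uniq inner⇒Q (chain-total ∣ ⊤ {n} ∣ ⊤ c∈)) ⟩
      ∑ 𝒞 (λ c → 2 + ∑ L (λ M → 𝟙 (Q? M) * ∑ L (pairIn c M)))
        ≡⟨ ∑-+ 𝒞 _ _ ⟩
      ∑ 𝒞 (λ _ → 2) + ∑ 𝒞 (λ c → ∑ L (λ M → 𝟙 (Q? M) * ∑ L (pairIn c M)))
        ≡⟨ cong₂ _+_ 2n! P≡ ⟩
      n ! * 2 + P ∎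
      where
      open ≤-Reasoning
      V≡ : V ≡ ∑ 𝒞 (λ c → ∑ L (λ A → 𝟙 (A ∈ᶜ? c)))
      V≡ = trans (∑-cong L (λ {A} _ → sym (count-∋ A))) (∑-swap L 𝒞 _)
      R≡ : R ≡ ∑ 𝒞 (λ c → ∑ L (λ M → 𝟙 (Q? M) * 𝟙 (M ∈ᶜ? c)))
      R≡ = trans (∑-cong L (λ {M} _ → trans (cong (𝟙 (Q? M) *_) (sym (count-∋ M))) (sym (∑-*ˡ 𝒞 (𝟙 (Q? M)) _))))
                 (∑-swap L 𝒞 _)
      2n! : ∑ 𝒞 (λ _ → 2) ≡ n ! * 2
      2n! = trans (∑-*ʳ 𝒞 2 (λ _ → 1)) (cong (_* 2) (count-maxChains n))
      P≡ : ∑ 𝒞 (λ c → ∑ L (λ M → 𝟙 (Q? M) * ∑ L (pairIn c M))) ≡ P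
      P≡ = trans (∑-swap 𝒞 L _) (∑-cong L λ {M} _ →
        trans (∑-*ˡ 𝒞 (𝟙 (Q? M)) _) (cong (𝟙 (Q? M) *_)
          (trans (∑-swap 𝒞 L _) (∑-cong L λ {A} _ → count-pairIn M A))))

    P≤ : 100 * P ≤ 99 * R
    P≤ = begin
      100 * P                                             ≡⟨ sym (∑-*ˡ L 100 _) ⟩
      ∑ L (λ M → 100 * (𝟙 (Q? M) * ∑ L (near M)))         ≤⟨ ∑-mono L (λ {M} M∈ → each M∈ (Q? M)) ⟩
      ∑ L (λ M → 99 * (𝟙 (Q? M) * weight M))              ≡⟨ ∑-*ˡ L 99 _ ⟩
      99 * R                                              ∎
      where
      open ≤-Reasoning
      each : ∀ {M} → M ∈ L → (d : Dec (Q M)) → 100 * (𝟙 d * ∑ L (near M)) ≤ 99 * (𝟙 d * weight M)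
      each M∈ (no _) = z≤n
      each {M} M∈ (yes q) = begin
        100 * (1 * ∑ L (near M)) ≡⟨ cong (100 *_) (*-identityˡ (∑ L (near M))) ⟩
        100 * ∑ L (near M)       ≤⟨ ∑-near M∈ q ⟩
        99 * weight M            ≡⟨ cong (99 *_) (sym (*-identityˡ (weight M))) ⟩
        99 * (1 * weight M)      ∎

  -- Since 100 P ≤ 99 R, the 100 R on the left of 100 (V + R) ≤ 200 n! + 100 P absorbs it and one R
  -- survives as the gain.
  weight-bound : 100 * ∑ L weight + ∑ L (λ M → 𝟙 (Q? M) * weight M) ≤ 200 * n !
  weight-bound = +-cancelʳ-≤ (99 * R) _ _ (begin
    100 * V + R + 99 * R    ≡⟨ regroup V R ⟩
    100 * (V + R)           ≤⟨ *-monoʳ-≤ 100 V+R≤ ⟩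
    100 * (n ! * 2 + P)     ≡⟨ expand (n !) P ⟩
    200 * n ! + 100 * P     ≤⟨ +-monoʳ-≤ (200 * n !) P≤ ⟩
    200 * n ! + 99 * R      ∎)
    where
    open ≤-Reasoning
    regroup : ∀ v r → 100 * v + r + 99 * r ≡ 100 * (v + r)
    regroup = solve-∀
    expand : ∀ f p → 100 * (f * 2 + p) ≡ 200 * f + 100 * p
    expand = solve-∀

-- From weights to cardinalities

-- Compare (t + a)! / a! with (t + b)! / b!, both products of t consecutive integers, factor by
-- factor.
!-exchange : ∀ t {a b} → a ≤ b → (t + a) ! * b ! ≤ a ! * (t + b) !
!-exchange zero    _ = ≤-refl
!-exchange (suc t) {a} {b} a≤b = begin
  suc (t + a) * (t + a) ! * b !     ≡⟨ *-assoc (suc (t + a)) ((t + a) !) (b !) ⟩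
  suc (t + a) * ((t + a) ! * b !)   ≤⟨ *-mono-≤ (s≤s (+-monoʳ-≤ t a≤b)) (!-exchange t a≤b) ⟩
  suc (t + b) * (a ! * (t + b) !)   ≡⟨ x∙yz≈y∙xz (suc (t + b)) (a !) _ ⟩
  a ! * (suc (t + b) * (t + b) !)   ∎
  where
  open ≤-Reasoning
  x∙yz≈y∙xz : ∀ x y z → x * (y * z) ≡ y * (x * z)
  x∙yz≈y∙xz = solve-∀

C*k!*[n∸k]! : ∀ {n k} → k ≤ n → (n C k) * ((n ∸ k) ! * k !) ≡ n !
C*k!*[n∸k]! {n} {k} k≤n = begin
  (n C k) * ((n ∸ k) ! * k !)  ≡⟨ cong₂ _*_ (nCk≡n!/k![n-k]! k≤n) (*-comm ((n ∸ k) !) (k !)) ⟩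
  (n ! / (k ! * (n ∸ k) !)) * (k ! * (n ∸ k) !) ≡⟨ m/n*n≡m (k![n∸k]!∣n! k≤n) ⟩
  n !                        ∎
  where
  open ≡-Reasoning
  instance _ = k !* (n ∸ k) !≢0

C≤1+nC1+k : ∀ n k → n C k ≤ suc n C suc k
C≤1+nC1+k n k = ≤-trans (m≤m+n (n C k) _) (≤-reflexive (nCk+nC[k+1]≡[n+1]C[k+1] n k))

C≤1+nC : ∀ n k → n C suc k ≤ suc n C suc k
C≤1+nC n k = ≤-trans (m≤n+m (n C suc k) (n C k)) (≤-reflexive (nCk+nC[k+1]≡[n+1]C[k+1] n k))

-- The smallest case is 13 C 6 = 1716. By Pascal's rule the coefficient does not drop when the upper
-- index, or both indices, grow by one.
202≤C : ∀ s p → 5 ≤ s → 6 ≤ p → 202 ≤ (2 + (s + p)) C p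
202≤C s p 5≤s 6≤p rewrite sym (m+[n∸m]≡n 5≤s) | sym (m+[n∸m]≡n 6≤p) = go (s ∸ 5) (p ∸ 6)
  where
  go : ∀ s p → 202 ≤ (7 + (s + (6 + p))) C (6 + p)
  go zero    zero    = ≤ᵇ⇒≤ 202 (13 C 6) _
  go zero    (suc p) = ≤-trans (go zero p) (C≤1+nC1+k (13 + p) (6 + p))
  go (suc s) p       = ≤-trans (go s p) (C≤1+nC (7 + (s + (6 + p))) (5 + p))

Σbin₂ : ∀ n → Σbin (2 + n) 2 ≡ (2 + n) C ⌈ n /2⌉ + (2 + n) C suc ⌈ n /2⌉
Σbin₂ n rewrite +-comm n 2 | m+n∸n≡m 2 ⌈ n /2⌉ | +-identityʳ ⌈ n /2⌉ | +-comm ⌈ n /2⌉ 1 =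
  cong ((2 + n) C ⌈ n /2⌉ +_) (+-identityʳ _)

⌈n/2⌉≤1+⌊n/2⌋ : ∀ n → ⌈ n /2⌉ ≤ suc ⌊ n /2⌋
⌈n/2⌉≤1+⌊n/2⌋ 0             = z≤n
⌈n/2⌉≤1+⌊n/2⌋ 1             = s≤s z≤n
⌈n/2⌉≤1+⌊n/2⌋ (suc (suc n)) = s≤s (⌈n/2⌉≤1+⌊n/2⌋ n)

-- With m = 2 + s + p, level p + 1 is a largest level, of size `c₁`, and its sets have the least
-- weight `w₁`. Level p has size `c₂` and weight `w₂`, the least weight off level p + 1.
module MiddleLevels (N : ℕ) where
  m p s c₁ c₂ w₁ w₂ : ℕ
  m = 2 + N
  p = ⌈ N /2⌉
  s = ⌊ N /2⌋
  c₁ = m C suc p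
  c₂ = m C p
  w₁ = suc s ! * suc p !
  w₂ = (2 + s) ! * p !

  m≡ : m ≡ 2 + (s + p)
  m≡ = cong (2 +_) (sym (⌊n/2⌋+⌈n/2⌉≡n N))

  m∸p : m ∸ p ≡ 2 + s
  m∸p = trans (cong (_∸ p) m≡) (m+n∸n≡m (2 + s) p)

  m∸1+p : m ∸ suc p ≡ suc s
  m∸1+p = trans (cong (_∸ suc p) m≡) (m+n∸n≡m (suc s) p)

  c₁w₁ : c₁ * w₁ ≡ m !
  c₁w₁ = trans (cong (λ k → c₁ * (k ! * suc p !)) (sym m∸1+p))
    (C*k!*[n∸k]! (≤-trans (s≤s (m≤n+m p (suc s))) (≤-reflexive (sym m≡))))

  c₂w₂ : c₂ * w₂ ≡ m !
  c₂w₂ = trans (cong (λ k → c₂ * (k ! * p !)) (sym m∸p))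
    (C*k!*[n∸k]! (≤-trans (m≤n+m p (2 + s)) (≤-reflexive (sym m≡))))

  -- A product of two factorials with fixed sum of arguments grows as the arguments move apart:
  -- `!-exchange` moves t = p - i units from the smaller one to the larger.
  w₂≤outer : ∀ {i j} → i ≤ p → i + j ≡ m → w₂ ≤ i ! * j !
  w₂≤outer {i} {j} i≤p i+j≡n = begin
    (2 + s) ! * p !            ≡⟨ *-comm ((2 + s) !) (p !) ⟩
    p ! * (2 + s) !            ≡⟨ cong (λ k → k ! * (2 + s) !) (sym t+i≡p) ⟩
    (t + i) ! * (2 + s) !      ≤⟨ !-exchange t (≤-trans i≤p (≤-trans (⌈n/2⌉≤1+⌊n/2⌋ N) (n≤1+n _))) ⟩
    i ! * (t + (2 + s)) !      ≡⟨ cong (λ k → i ! * k !) (sym j≡) ⟩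
    i ! * j !                  ∎
    where
    open ≤-Reasoning
    t = p ∸ i
    t+i≡p : t + i ≡ p
    t+i≡p = m∸n+n≡m i≤p
    regroup : ∀ t i s → 2 + (s + (t + i)) ≡ i + (t + (2 + s))
    regroup = solve-∀
    j≡ : j ≡ t + (2 + s)
    j≡ = +-cancelˡ-≡ i _ _ (trans i+j≡n (trans m≡ (trans (cong (λ k → 2 + (s + k)) (sym t+i≡p)) (regroup t i s))))

  w₁≤w₂ : w₁ ≤ w₂
  w₁≤w₂ = begin
    suc s ! * suc p !   ≡⟨ *-comm (suc s !) (suc p !) ⟩
    suc p ! * suc s !   ≤⟨ !-exchange 1 (⌈n/2⌉≤1+⌊n/2⌋ N) ⟩
    p ! * (2 + s) !     ≡⟨ *-comm (p !) ((2 + s) !) ⟩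
    (2 + s) ! * p !     ∎
    where open ≤-Reasoning

  atMiddle? : (A : Subset m) → Dec (∣ A ∣ ≡ suc p)
  atMiddle? A = ∣ A ∣ ≟ suc p

  middle-weight : ∀ {A : Subset m} → ∣ A ∣ ≡ suc p → weight A ≡ w₁
  middle-weight e = cong₂ (λ x y → x ! * y !) (trans (cong (m ∸_) e) m∸1+p) e

  w₂≤weight : ∀ {A : Subset m} → ∣ A ∣ ≢ suc p → w₂ ≤ weight A
  w₂≤weight {A} A≢ with ∣ A ∣ ≤? p
  ... | yes a≤p = ≤-trans (w₂≤outer a≤p (m+[n∸m]≡n (∣p∣≤n A))) (≤-reflexive (*-comm (∣ A ∣ !) _))
  -- Above level p + 1 the complement is used: it has at most m - (p + 2) = s ≤ p elements.
  ... | no a≰p  = w₂≤outer (begin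
    m ∸ ∣ A ∣           ≤⟨ ∸-monoʳ-≤ m (≤∧≢⇒< (≰⇒> a≰p) (A≢ ∘ sym)) ⟩
    m ∸ (2 + p)         ≡⟨ trans (cong (_∸ (2 + p)) m≡) (m+n∸n≡m s p) ⟩
    s                   ≤⟨ ⌊n/2⌋≤⌈n/2⌉ N ⟩
    p                   ∎) (m∸n+n≡m (∣p∣≤n A))
    where open ≤-Reasoning

  module _ {L : List (Subset m)} (uniq : Unique L) where

    -- One level is an antichain of constant weight `w₁`, so `lym` bounds its size by m! / `w₁`.
    middle≤c₁ : ∑ L (𝟙 ∘ atMiddle?) ≤ c₁
    middle≤c₁ = *-cancelʳ-≤ _ _ w₁ {{m*n≢0 _ _ {{suc s !≢0}} {{suc p !≢0}}}} (begin
      ∑ L (𝟙 ∘ atMiddle?) * w₁              ≡⟨ sym (∑-*ʳ L w₁ _) ⟩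
      ∑ L (λ A → 𝟙 (atMiddle? A) * w₁)      ≡⟨ ∑-cong L (λ {A} _ → each A (atMiddle? A)) ⟩
      ∑ L (λ A → 𝟙 (atMiddle? A) * weight A)
        ≤⟨ lym atMiddle? uniq (λ { _ _ a b A⊂B → <⇒≢ (p⊂q⇒∣p∣<∣q∣ A⊂B) (trans a (sym b)) }) ⟩
      m !                                   ≡⟨ sym c₁w₁ ⟩
      c₁ * w₁                               ∎)
      where
      open ≤-Reasoning
      each : ∀ A (d : Dec (∣ A ∣ ≡ suc p)) → 𝟙 d * w₁ ≡ 𝟙 d * weight A
      each A (yes e) = cong (1 *_) (sym (middle-weight {A} e))
      each A (no _)  = refl

    -- At most `c₁` sets can have the small weight `w₁`; every other set weighs at least `w₂`.
    -- Charging the deficit e = `w₂` - `w₁` to level p + 1 makes each set cost at least `w₂`, and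
    -- the identities `c₁` * `w₁` = `c₂` * `w₂` = m! convert the total weight into a count.
    length-bound : ∀ k y → k * ∑ L weight ≤ (k + y) * m ! → k * length L ≤ k * c₁ + y * c₂
    length-bound k y kV≤ = *-cancelʳ-≤ _ _ w₂ {{m*n≢0 _ _ {{(2 + s) !≢0}} {{p !≢0}}}} (begin
      k * length L * w₂                       ≡⟨ *-assoc k (length L) w₂ ⟩
      k * (length L * w₂)                     ≤⟨ *-monoʳ-≤ k count ⟩
      k * (∑ L weight + c₁ * e)               ≡⟨ *-distribˡ-+ k (∑ L weight) (c₁ * e) ⟩
      k * ∑ L weight + k * (c₁ * e)           ≤⟨ +-monoˡ-≤ _ kV≤ ⟩
      (k + y) * m ! + k * (c₁ * e)            ≡⟨ cong (_+ k * (c₁ * e)) (*-distribʳ-+ (m !) k y) ⟩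
      k * m ! + y * m ! + k * (c₁ * e)        ≡⟨ cong₂ (λ a b → k * a + y * b + k * (c₁ * e)) (sym c₁w₁) (sym c₂w₂) ⟩
      k * (c₁ * w₁) + y * (c₂ * w₂) + k * (c₁ * e) ≡⟨ regroup k y c₁ c₂ w₁ w₂ e ⟩
      k * c₁ * (w₁ + e) + y * c₂ * w₂         ≡⟨ cong (λ z → k * c₁ * z + y * c₂ * w₂) w₁+e ⟩
      k * c₁ * w₂ + y * c₂ * w₂               ≡⟨ sym (*-distribʳ-+ w₂ (k * c₁) (y * c₂)) ⟩
      (k * c₁ + y * c₂) * w₂                  ∎)
      where
      open ≤-Reasoning
      e = w₂ ∸ w₁
      w₁+e : w₁ + e ≡ w₂
      w₁+e = m+[n∸m]≡n w₁≤w₂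
      regroup : ∀ k y c d v w e → k * (c * v) + y * (d * w) + k * (c * e) ≡ k * c * (v + e) + y * d * w
      regroup = solve-∀
      each : ∀ A → w₂ ≤ weight A + 𝟙 (atMiddle? A) * e
      each A with atMiddle? A
      ... | yes a = ≤-reflexive (trans (sym w₁+e) (cong₂ _+_ (sym (middle-weight {A} a)) (sym (*-identityˡ e))))
      ... | no ¬a = ≤-trans (w₂≤weight {A} ¬a) (m≤m+n _ _)
      count : length L * w₂ ≤ ∑ L weight + c₁ * e
      count = begin
        length L * w₂                                        ≡⟨ sym (∑-const L w₂) ⟩
        ∑ L (λ _ → w₂)                                       ≤⟨ ∑-mono L (λ {A} _ → each A) ⟩
        ∑ L (λ A → weight A + 𝟙 (atMiddle? A) * e)           ≡⟨ ∑-+ L weight _ ⟩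
        ∑ L weight + ∑ L (λ A → 𝟙 (atMiddle? A) * e)         ≡⟨ cong (∑ L weight +_) (∑-*ʳ L e _) ⟩
        ∑ L weight + ∑ L (𝟙 ∘ atMiddle?) * e                 ≤⟨ +-monoʳ-≤ (∑ L weight) (*-monoˡ-≤ e middle≤c₁) ⟩
        ∑ L weight + c₁ * e                                  ∎

-- The sets ∅ and [n], and the final count.

Proper : Subset n → Set
Proper {n} A = 0 < ∣ A ∣ × ∣ A ∣ < n

proper? : Decidable (Proper {n})
proper? {n} A = (0 <? ∣ A ∣) ×-dec (∣ A ∣ <? n)

∣A∣≡0⇒⊥≡A : ∀ {A : Subset n} → ∣ A ∣ ≡ 0 → ⊥ ≡ A
∣A∣≡0⇒⊥≡A {n} e = ⊆∧∣≡∣⇒≡ ⊥⊆ (trans (∣⊥∣≡0 n) (sym e))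

length≤proper+2 : ∀ {F : List (Subset n)} → Unique F → length F ≤ length (filter proper? F) + 2
length≤proper+2 {n} {F} uniq = begin
  length F
    ≡⟨ length≡∑ F ⟩
  ∑ F (λ _ → 1)
    ≤⟨ ∑-mono F (λ {A} _ → each A) ⟩
  ∑ F (λ A → 𝟙 (proper? A) * 1 + (𝟙 (∣ A ∣ ≟ 0) + 𝟙 (∣ A ∣ ≟ n)))
    ≡⟨ trans (∑-+ F _ _) (cong (∑ F (λ A → 𝟙 (proper? A) * 1) +_) (∑-+ F _ _)) ⟩
  ∑ F (λ A → 𝟙 (proper? A) * 1) + (∑ F (λ A → 𝟙 (∣ A ∣ ≟ 0)) + ∑ F (λ A → 𝟙 (∣ A ∣ ≟ n)))
    ≤⟨ +-mono-≤ (≤-reflexive (trans (sym (∑-filter proper? F (λ _ → 1))) (sym (length≡∑ (filter proper? F)))))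
         (+-mono-≤ (∑-𝟙≤1 (λ A → ∣ A ∣ ≟ 0) uniq (λ _ _ a b → trans (sym (∣A∣≡0⇒⊥≡A a)) (∣A∣≡0⇒⊥≡A b)))
                   (∑-𝟙≤1 (λ A → ∣ A ∣ ≟ n) uniq (λ _ _ a b → trans (∣p∣≡n⇒p≡⊤ a) (sym (∣p∣≡n⇒p≡⊤ b))))) ⟩
  length (filter proper? F) + 2 ∎
  where
  open ≤-Reasoning
  length≡∑ : ∀ (xs : List (Subset n)) → length xs ≡ ∑ xs (λ _ → 1)
  length≡∑ xs = sym (trans (∑-const xs 1) (*-identityʳ _))
  each : ∀ A → 1 ≤ 𝟙 (proper? A) * 1 + (𝟙 (∣ A ∣ ≟ 0) + 𝟙 (∣ A ∣ ≟ n))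
  each A with ∣ A ∣ ≟ 0 | ∣ A ∣ ≟ n
  ... | yes _ | _     = m≤n⇒m≤o+n (𝟙 (proper? A) * 1) (s≤s z≤n)
  ... | no _  | yes _ = m≤n⇒m≤o+n (𝟙 (proper? A) * 1) ≤-refl
  ... | no ≢0 | no ≢n = ≤-trans
    (≤-reflexive (sym (cong (_* 1) (𝟙-yes (proper? A) (n≢0⇒n>0 ≢0 , ≤∧≢⇒< (∣p∣≤n A) ≢n))))) (m≤m+n _ 0)

module _ (N : ℕ) (13≤m : 13 ≤ 2 + N) {F : List (Subset (2 + N))} (uniq : Unique F) (forb : Forbidden F) where
  open MiddleLevels N

  private
    L = filter proper? F

    uniqL : Unique L
    uniqL = Unique.filter⁺ proper? uniq

    L⊆F : ∀ {A} → A ∈ L → A ∈ F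
    L⊆F = proj₁ ∘ ∈-filter⁻ proper?

    -- The witnesses range over `F`, not `L`, so that ∅ or [n] can serve as one; `¬inner-antichain`
    -- relies on this.
    Inner : Subset m → Set
    Inner M = Any (_⊂ M) F × Any (M ⊂_) F

    inner? : Decidable Inner
    inner? M = any? (_⊂? M) F ×-dec any? (M ⊂?_) F

    ¬butterfly : ∀ {A B C D} → A ∈ F → B ∈ F → C ∈ F → D ∈ F → A ≢ B → C ≢ D →
      A ⊂ C → A ⊂ D → B ⊂ C → B ⊂ D → ¬ (∣ A ∣ ≡ ∣ B ∣ ⊎ ∣ C ∣ ≡ ∣ D ∣)
    ¬butterfly A∈ B∈ C∈ D∈ A≢B C≢D AC AD BC BD =
      forb _ _ _ _ A∈ B∈ C∈ D∈ A≢B (⊂⇒≢ AC) (⊂⇒≢ AD) (⊂⇒≢ BC) (⊂⇒≢ BD) C≢D AC AD BC BD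

    -- With D a member of `F` above `M`, distinct A and B of equal size below `M` would both lie
    -- below `M` and D, which is forbidden.
    below-inj : ∀ {M A B} → M ∈ L → Inner M → A ∈ L → B ∈ L → A ⊂ M → B ⊂ M → ∣ A ∣ ≡ ∣ B ∣ → A ≡ B
    below-inj {A = A} {B} M∈ (_ , up) A∈ B∈ AM BM e with A ≟ˢ B
    ... | yes A≡B = A≡B
    ... | no A≢B with D , D∈ , MD ← find up = contradiction (inj₁ e)
      (¬butterfly (L⊆F A∈) (L⊆F B∈) (L⊆F M∈) D∈ A≢B (⊂⇒≢ MD) AM (⊂-trans AM MD) BM (⊂-trans BM MD))

    -- Dually, with D below `M`, the sets D and `M` would both lie below A and B of equal size.
    above-inj : ∀ {M A B} → M ∈ L → Inner M → A ∈ L → B ∈ L → M ⊂ A → M ⊂ B → ∣ A ∣ ≡ ∣ B ∣ → A ≡ B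
    above-inj {A = A} {B} M∈ (down , _) A∈ B∈ MA MB e with A ≟ˢ B
    ... | yes A≡B = A≡B
    ... | no A≢B with D , D∈ , DM ← find down = contradiction (inj₂ e)
      (¬butterfly D∈ (L⊆F M∈) (L⊆F A∈) (L⊆F B∈) (⊂⇒≢ DM) A≢B (⊂-trans DM MA) (⊂-trans DM MB) MA MB)

    V R : ℕ
    V = ∑ L weight
    R = ∑ L (λ M → 𝟙 (inner? M) * weight M)

    100V+R≤ : 100 * V + R ≤ 200 * m !
    100V+R≤ = weight-bound inner? 13≤m uniqL (proj₂ ∘ ∈-filter⁻ proper? {xs = F})
      (λ A∈ _ B∈ AM MB → lose (L⊆F A∈) AM , lose (L⊆F B∈) MB) below-inj above-inj

    -- If ∅ ∈ F every non-maximal member of L is inner, if [n] ∈ F every non-minimal one.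
    ¬inner-antichain : ∀ {E} → E ∈ F → ¬ Proper E →
      ∀ {A B} → A ∈ L → B ∈ L → ¬ Inner A → ¬ Inner B → ¬ A ⊂ B
    ¬inner-antichain {E} E∈ ¬properE {A} {B} A∈ B∈ ¬innerA ¬innerB A⊂B with ∣ E ∣ ≟ 0
    ... | yes ∣E∣≡0 = ¬innerA (lose E∈ E⊂A , lose (L⊆F B∈) A⊂B)
      where
      E⊂A : E ⊂ A
      E⊂A = subst (_⊂ A) (∣A∣≡0⇒⊥≡A {A = E} ∣E∣≡0) (⊆∧≢⇒⊂ ⊥⊆ λ ⊥≡A →
        <⇒≢ (proj₁ (proj₂ (∈-filter⁻ proper? {xs = F} A∈))) (trans (sym (∣⊥∣≡0 m)) (cong ∣_∣ ⊥≡A)))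
    ... | no ∣E∣≢0 = ¬innerB (lose (L⊆F A∈) A⊂B , lose E∈ B⊂E)
      where
      ∣E∣≡m : ∣ E ∣ ≡ m
      ∣E∣≡m = ≤-antisym (∣p∣≤n E) (≮⇒≥ λ E<n → ¬properE (n≢0⇒n>0 ∣E∣≢0 , E<n))
      B⊂E : B ⊂ E
      B⊂E = subst (B ⊂_) (sym (∣p∣≡n⇒p≡⊤ {p = E} ∣E∣≡m)) (⊆∧≢⇒⊂ ⊆⊤ λ B≡⊤ →
        <⇒≢ (proj₂ (proj₂ (∈-filter⁻ proper? {xs = F} B∈))) (trans (cong ∣_∣ B≡⊤) (∣⊤∣≡n m)))

    -- The non-inner part of `V` is at most m! by `lym`, so V ≤ R + m!. Adding this to 100 V + R ≤
    -- 200 m! eliminates R.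
    101V≤ : ∀ {E} → E ∈ F → ¬ Proper E → 101 * V ≤ 201 * m !
    101V≤ E∈ ¬properE = begin
      101 * V                      ≡⟨ +-comm V (100 * V) ⟩
      100 * V + V                  ≤⟨ +-monoʳ-≤ (100 * V) V≤R+R′ ⟩
      100 * V + (R + R′)           ≡⟨ sym (+-assoc (100 * V) R R′) ⟩
      100 * V + R + R′             ≤⟨ +-mono-≤ 100V+R≤ (lym (¬? ∘ inner?) uniqL (¬inner-antichain E∈ ¬properE)) ⟩
      200 * m ! + m !              ≡⟨ +-comm (200 * m !) (m !) ⟩
      201 * m !                    ∎
      where
      open ≤-Reasoning
      R′ = ∑ L (λ M → 𝟙 (¬? (inner? M)) * weight M)
      V≤R+R′ : V ≤ R + R′
      V≤R+R′ = ≤-trans (∑-mono L λ {M} _ → each M (inner? M)) (≤-reflexive (∑-+ L _ _))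
        where
        each : ∀ M (d : Dec (Inner M)) → weight M ≤ 𝟙 d * weight M + 𝟙 (¬? d) * weight M
        each M (yes _) = ≤-trans (≤-reflexive (sym (*-identityˡ (weight M)))) (m≤m+n (1 * weight M) (0 * weight M))
        each M (no _)  = ≤-reflexive (sym (*-identityˡ (weight M)))

    -- The number 202 is the cost of ∅ and [n] after scaling by 101.
    202≤c₂ : 202 ≤ c₂
    202≤c₂ = subst (λ k → 202 ≤ k C p) (sym m≡)
      (202≤C s p (⌊n/2⌋-mono (≤-pred (≤-pred 13≤m))) (⌈n/2⌉-mono (≤-pred (≤-pred 13≤m))))

  length≤c₁+c₂ : length F ≤ c₁ + c₂
  length≤c₁+c₂ with All.all? proper? F
  ... | yes allProper = *-cancelˡ-≤ 100 (begin
    100 * length F        ≡⟨ cong (λ xs → 100 * length xs) (sym (filter-all proper? allProper)) ⟩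
    100 * length L        ≤⟨ length-bound uniqL 100 100 (≤-trans (m≤m+n (100 * V) R) 100V+R≤) ⟩
    100 * c₁ + 100 * c₂   ≡⟨ sym (*-distribˡ-+ 100 c₁ c₂) ⟩
    100 * (c₁ + c₂)       ∎)
    where open ≤-Reasoning
  ... | no ¬allProper with E , E∈ , ¬properE ← find (¬All⇒Any¬ proper? F ¬allProper) = *-cancelˡ-≤ 101 (begin
    101 * length F                ≤⟨ *-monoʳ-≤ 101 (length≤proper+2 uniq) ⟩
    101 * (length L + 2)          ≡⟨ *-distribˡ-+ 101 (length L) 2 ⟩
    -- `length-bound` with k = 101 and y = 100 leaves one `c₂` to spare, which pays for the 202.
    101 * length L + 202          ≤⟨ +-mono-≤ (length-bound uniqL 101 100 (101V≤ E∈ ¬properE)) 202≤c₂ ⟩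
    101 * c₁ + 100 * c₂ + c₂      ≡⟨ collect c₁ c₂ ⟩
    101 * (c₁ + c₂)               ∎)
    where
    open ≤-Reasoning
    collect : ∀ a b → 101 * a + 100 * b + b ≡ 101 * (a + b)
    collect = solve-∀

theorem2p16 : (n : ℕ) → 13 ≤ n → (F : List (Subset n)) → Unique F →
    Forbidden F → length F ≤ Σbin n 2
theorem2p16 (suc (suc N)) 13≤m F uniq forb = ≤-trans (length≤c₁+c₂ N 13≤m uniq forb)
  (≤-reflexive (trans (+-comm ((2 + N) C suc ⌈ N /2⌉) _) (sym (Σbin₂ N))))
theorem2p16 1 (s≤s ())
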